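{- For every prime $N$ and every integer $m\ge2$ one has $S(m,N)\ge S^{\mathbb{Z}}(m,N)$.
   Context: Let $N$ be prime, $m\ge2$, $\mathbb{Z}_N=\mathbb{Z}/N\mathbb{Z}$ with elements identified with $0,\dots,N-1$. A hyperplane in $\mathbb{Z}_N^m$ is a set $H=\{x:h\cdot x=0\}$ for a nonzero normal $h\in\mathbb{Z}_N^m$. Let $n(H)$ be the minimum, over all normals $h$ defining $H$, of the integer $\sum_{i=1}^m h_i$ (sum of representatives in $\{0,\dots,N-1\}$). Index all hyperplanes of $\mathbb{Z}_N^m$ as $H_1,H_2,\dots$ so that $n(H_1)\le n(H_2)\le\cdots$ and put $S(m,N)=\sum_{i=1}^{N+1}n(H_i)$, the sum of the $N+1$ smallest values of $n$ (there are at least $N+1$ hyperplanes). Let $c_i(m)$ be the number of $(x_1,\dots,x_m)\in\mathbb{Z}_{\ge0}^m$ with $\sum_j x_j=i$ and $\gcd(x_1,\dots,x_m)=1$. Let $k=k^{\mathbb{Z}}_{m,N}=\min\{k\ge0:\sum_{i=1}^{k+1}c_i(m)>N+1\}$ and $$S^{\mathbb{Z}}(m,N)=\sum_{i=1}^{k}i\,c_i(m)+\Bigl(N+1-\sum_{i=1}^{k}c_i(m)\Bigr)(k+1).$$ -}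

module Defs where

open import Data.Fin using (Fin; toℕ)
open import Data.Fin.Properties using (any?; all?)
open import Data.List using (List; []; _∷_; map; filter; deduplicate; take; upTo; allFin; length; cartesianProductWith)
open import Data.List.Membership.Propositional using (_∈_)
open import Data.List.Membership.Propositional.Properties using (∈-cartesianProductWith⁺; ∈-upTo⁺; ∈-filter⁺)
open import Data.List.Relation.Unary.All using (toList)
open import Data.List.Relation.Unary.All.Properties using (all-filter)
open import Data.List.Relation.Unary.Any using (here; there)
open import Data.List.Sort using (sort)
open import Data.Nat using (ℕ; zero; suc; _+_; _*_; _∸_; _≤_; _<_; _>_; z≤n; s≤s; _≟_; _>?_)
open import Data.Nat.Divisibility using (_∣_; _∣?_)
open import Data.Nat.GCD using (gcd; gcd-zeroˡ)
open import Data.Nat.ListAction using (sum)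
open import Data.Nat.Properties using (≤-decTotalOrder; ≤-trans; ≤-reflexive; +-mono-≤; +-comm; +-identityʳ; m≤n+m)
open import Data.Product using (Σ; ∃; _×_; _,_; proj₁; proj₂)
open import Data.Vec as Vec using (Vec; []; _∷_; replicate)
open import Data.Vec.Properties using (≡-dec)
open import Level using (0ℓ)
open import Relation.Binary.PropositionalEquality using (_≡_; _≢_; refl; cong; trans)
open import Relation.Nullary using (Dec; yes; no; ¬?; contradiction)
open import Relation.Nullary.Decidable using (map′; _×-dec_; _→-dec_)
open import Relation.Unary using (Pred; Decidable; _≐_)

IsMinimum : Pred ℕ 0ℓ → ℕ → Set
IsMinimum P k = P k × (∀ j → P j → k ≤ j)

minimum : {P : Pred ℕ 0ℓ} → Decidable P → ∃ P → ∃ (IsMinimum P)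
minimum {P} P? (b , Pb) = go b P? Pb
  where
  go : ∀ {Q : Pred ℕ 0ℓ} b → Decidable Q → Q b → ∃ (IsMinimum Q)
  go zero    Q? Qb = 0 , Qb , λ _ _ → z≤n
  go {Q} (suc b) Q? Qb with Q? 0
  ... | yes Q0 = 0 , Q0 , λ _ _ → z≤n
  ... | no ¬Q0 with go {λ j → Q (suc j)} b (λ j → Q? (suc j)) Qb
  ...   | k , Qk , least = suc k , Qk , λ where
            zero    Q0 → contradiction Q0 ¬Q0
            (suc j) Qj → s≤s (least j Qj)

tuples : {A : Set} (m : ℕ) → List A → List (Vec A m)
tuples zero    xs = [] ∷ []
tuples (suc m) xs = cartesianProductWith _∷_ xs (tuples m xs)

-- An element of ℤ/N is given by its representative in {0,…,N-1}.
Point : ℕ → ℕ → Set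
Point N m = Vec (Fin N) m

module _ {N : ℕ} where

  allPoints? : ∀ {m} {P : Pred (Point N m) 0ℓ} → Decidable P → Dec (∀ x → P x)
  allPoints? {zero}  P? = map′ (λ { p [] → p }) (λ f → f []) (P? [])
  allPoints? {suc m} P? =
    map′ (λ { f (a ∷ x) → f a x }) (λ f a x → f (a ∷ x))
         (all? λ a → allPoints? λ x → P? (a ∷ x))

  anyPoint? : ∀ {m} {P : Pred (Point N m) 0ℓ} → Decidable P → Dec (∃ P)
  anyPoint? {zero}  P? = map′ (λ p → [] , p) (λ { ([] , p) → p }) (P? [])
  anyPoint? {suc m} P? =
    map′ (λ { (a , x , p) → a ∷ x , p }) (λ { (a ∷ x , p) → a , x , p })
         (any? λ a → anyPoint? λ x → P? (a ∷ x))

  representatives : ∀ {m} → Point N m → Vec ℕ m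
  representatives = Vec.map toℕ

  _·_ : ∀ {m} → Point N m → Point N m → ℕ
  h · x = Vec.sum (Vec.zipWith _*_ (representatives h) (representatives x))

  -- The set {x : h·x = 0 in ℤ/N}.
  ⟨_⟩^⊥ : ∀ {m} → Point N m → Pred (Point N m) 0ℓ
  ⟨ h ⟩^⊥ x = N ∣ h · x

  weight : ∀ {m} → Point N m → ℕ
  weight h = Vec.sum (representatives h)

  Nonzero : ∀ {m} → Pred (Point N m) 0ℓ
  Nonzero {m} h = representatives h ≢ replicate m 0

  nonzero? : ∀ {m} → Decidable (Nonzero {m})
  nonzero? {m} h = ¬? (≡-dec _≟_ (representatives h) (replicate m 0))

  ≐? : ∀ {m} {P Q : Pred (Point N m) 0ℓ} → Decidable P → Decidable Q → Dec (P ≐ Q)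
  ≐? P? Q? =
    map′ (λ f → (λ {x} → f x .proj₁) , (λ {x} → f x .proj₂))
         (λ e x → (λ p → proj₁ e p) , (λ q → proj₂ e q))
         (allPoints? λ x → (P? x →-dec Q? x) ×-dec (Q? x →-dec P? x))

-- A hyperplane is presented by one of its normals; it is its underlying set
-- ⟦ H ⟧ that matters, so hyperplanes are compared by _≈_ and never by _≡_.
Hyperplane : ℕ → ℕ → Set
Hyperplane N m = Σ (Point N m) Nonzero

module _ {N m : ℕ} where

  ⟦_⟧ : Hyperplane N m → Pred (Point N m) 0ℓ
  ⟦ h , _ ⟧ = ⟨ h ⟩^⊥

  _≈_ : Hyperplane N m → Hyperplane N m → Set
  H ≈ H′ = ⟦ H ⟧ ≐ ⟦ H′ ⟧

  _≈?_ : (H H′ : Hyperplane N m) → Dec (H ≈ H′)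
  (h , _) ≈? (h′ , _) = ≐? (λ x → N ∣? h · x) (λ x → N ∣? h′ · x)

  IsNormal : Hyperplane N m → Pred (Point N m) 0ℓ
  IsNormal H h = Nonzero h × (⟦ H ⟧ ≐ ⟨ h ⟩^⊥)

  isNormal? : (H : Hyperplane N m) → Decidable (IsNormal H)
  isNormal? (h₀ , _) h =
    nonzero? h ×-dec ≐? (λ x → N ∣? h₀ · x) (λ x → N ∣? h · x)

  NormalWeight : Hyperplane N m → Pred ℕ 0ℓ
  NormalWeight H w = ∃ λ h → IsNormal H h × weight h ≡ w

  minNormalWeight : (H : Hyperplane N m) → ∃ (IsMinimum (NormalWeight H))
  minNormalWeight H@(h , h≢0) =
    minimum (λ w → anyPoint? λ h → isNormal? H h ×-dec (weight h ≟ w))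
            (weight h , h , (h≢0 , (λ p → p) , (λ p → p)) , refl)

  n : Hyperplane N m → ℕ
  n H = proj₁ (minNormalWeight H)

-- All hyperplanes, each underlying set occurring exactly once.
hyperplanes : (m N : ℕ) → List (Hyperplane N m)
hyperplanes m N =
  deduplicate _≈?_ (toList (all-filter nonzero? (tuples m (allFin N))))

S : (m N : ℕ) → ℕ
S m N = sum (take (N + 1) (sort ≤-decTotalOrder (map n (hyperplanes m N))))

gcdVec : ∀ {m} → Vec ℕ m → ℕ
gcdVec = Vec.foldr′ gcd 0

PrimitiveOfSum : ∀ {m} → ℕ → Pred (Vec ℕ m) 0ℓ
PrimitiveOfSum i x = Vec.sum x ≡ i × gcdVec x ≡ 1

primitiveOfSum? : ∀ {m} i → Decidable (PrimitiveOfSum {m} i)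
primitiveOfSum? i x = (Vec.sum x ≟ i) ×-dec (gcdVec x ≟ 1)

-- The entries of a vector in (ℤ≥0)^m with sum i are all at most i, so it
-- suffices to search the box {0,…,i}^m.
c : (i m : ℕ) → ℕ
c i m = length (filter (primitiveOfSum? i) (tuples m (upTo (suc i))))

-- Σ₁ k f = f 1 + ⋯ + f k
Σ₁ : ℕ → (ℕ → ℕ) → ℕ
Σ₁ zero    f = 0
Σ₁ (suc k) f = Σ₁ k f + f (suc k)

-- (1, i, 0, …, 0) is primitive with sum 1 + i; hence Σ₁ k c is unbounded in k
-- and the minimum defining kᶻ exists.
c-positive : ∀ i {m} → 2 ≤ m → 1 ≤ c (suc i) m
c-positive i {suc (suc m)} (s≤s (s≤s z≤n)) =
  nonempty (∈-filter⁺ (primitiveOfSum? (suc i)) v∈ (sum-v , gcd-zeroˡ (gcdVec (i ∷ replicate m 0))))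
  where
  nonempty : ∀ {A : Set} {x : A} {xs} → x ∈ xs → 1 ≤ length xs
  nonempty (here _)  = s≤s z≤n
  nonempty (there _) = s≤s z≤n

  box : List ℕ
  box = upTo (suc (suc i))

  cons∈ : ∀ {m a} {x : Vec ℕ m} → a < suc (suc i) → x ∈ tuples m box → (a ∷ x) ∈ tuples (suc m) box
  cons∈ a< x∈ = ∈-cartesianProductWith⁺ _∷_ (∈-upTo⁺ {suc (suc i)} a<) x∈

  zeros∈ : ∀ m → replicate m 0 ∈ tuples m box
  zeros∈ zero    = here refl
  zeros∈ (suc m) = cons∈ (s≤s z≤n) (zeros∈ m)

  v∈ : (1 ∷ i ∷ replicate m 0) ∈ tuples (suc (suc m)) box
  v∈ = cons∈ (s≤s (s≤s z≤n)) (cons∈ (s≤s (m≤n+m i 1)) (zeros∈ m))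

  sum-zeros : ∀ m → Vec.sum (replicate m 0) ≡ 0
  sum-zeros zero    = refl
  sum-zeros (suc m) = sum-zeros m

  sum-v : Vec.sum (1 ∷ i ∷ replicate m 0) ≡ suc i
  sum-v = cong suc (trans (cong (i +_) (sum-zeros m)) (+-identityʳ i))

Σ₁c-unbounded : ∀ k {m} → 2 ≤ m → k ≤ Σ₁ k (λ i → c i m)
Σ₁c-unbounded zero    2≤m = z≤n
Σ₁c-unbounded (suc k) 2≤m =
  ≤-trans (≤-reflexive (+-comm 1 k))
          (+-mono-≤ (Σ₁c-unbounded k 2≤m) (c-positive k 2≤m))

ExceedsAt : (m N : ℕ) → Pred ℕ 0ℓ
ExceedsAt m N k = Σ₁ (k + 1) (λ i → c i m) > N + 1

minExceeding : (m N : ℕ) → 2 ≤ m → ∃ (IsMinimum (ExceedsAt m N))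
minExceeding m N 2≤m =
  minimum (λ k → Σ₁ (k + 1) (λ i → c i m) >? N + 1)
          (N + 1 , ≤-trans (≤-reflexive (+-comm 1 (N + 1))) (Σ₁c-unbounded (N + 1 + 1) 2≤m))

kᶻ : (m N : ℕ) → 2 ≤ m → ℕ
kᶻ m N 2≤m = proj₁ (minExceeding m N 2≤m)

-- The subtraction never truncates: c 1 m + ⋯ + c k m ≤ N + 1 for k = kᶻ m N,
-- trivially if k = 0 and by minimality of k otherwise.
Sᶻ : (m N : ℕ) → 2 ≤ m → ℕ
Sᶻ m N 2≤m = Σ₁ k (λ i → i * c i m) + (N + 1 ∸ Σ₁ k (λ i → c i m)) * (k + 1)
  where
  k : ℕ
  k = kᶻ m N 2≤m

{-# OPTIONS --safe #-}
module Submission where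

-- A normal h of H of least weight has coprime entries: if d divides all of
-- them then d is invertible mod N and h/d is again a normal of H.  As h
-- determines H, at most c i m hyperplanes have n H = i.  Put K = k + 1.  Since
-- v ≥ K ∸ (K ∸ v), any N + 1 of the values n H satisfy
--   Σ n H ≥ (N+1) K − Σ_H (K ∸ n H) ≥ (N+1) K − Σ_{i≤k} (K − i) c i m,
-- and the right-hand side is Sᶻ m N.  Sortedness plays no role, but there must
-- be N + 1 hyperplanes; the normals (1,0,0,…) and (a,N−1,0,…) supply them.

open import Defs
open import Data.Nat using (ℕ; _≤_; _≥_)
open import Data.Nat.Primality using (Prime)

open import Data.Bool using (true; false)
open import Data.Fin using (Fin; zero; suc; toℕ; fromℕ; fromℕ<)
open import Data.Fin.Properties using (injective⇒≤; toℕ<n; toℕ-injective; toℕ-fromℕ; toℕ-fromℕ<)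
open import Data.List using (List; []; _∷_; map; filter; take; length; lookup; upTo; allFin)
open import Data.List.Membership.Propositional using (_∈_)
open import Data.List.Membership.Propositional.Properties using (∈-cartesianProductWith⁺; ∈-allFin; ∈-upTo⁺; ∈-filter⁺; ∈-lookup)
open import Data.List.Properties using (filter-accept; length-map; length-take; map-∘; take-map)
open import Data.List.Relation.Binary.Permutation.Propositional.Properties using (map⁺; ↭-length)
open import Data.List.Relation.Unary.All as All using (All; []; _∷_; toList)
open import Data.List.Relation.Unary.All.Properties using (all-filter)
open import Data.List.Relation.Unary.AllPairs using (AllPairs; []; _∷_)
import Data.List.Relation.Unary.AllPairs.Properties as AllPairs
open import Data.List.Relation.Unary.Any as Any using (Any; here; there)
import Data.List.Relation.Unary.Any.Properties as Any
open import Data.List.Relation.Unary.Unique.DecSetoid.Properties using (deduplicate-!)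
open import Data.List.Sort using (sort; sort-↭)
open import Data.Nat using (zero; suc; _+_; _*_; _∸_; _<_; z≤n; s≤s; _≟_; NonZero; ≢-nonZero)
open import Data.Nat.Divisibility using (_∣_; divides; ∣-trans; ∣-refl; ∣⇒≤; ∣m+n∣m⇒∣n; m∣m*n; ∣n⇒∣m*n; _∣0)
open import Data.Nat.GCD using (gcd[m,n]∣m; gcd[m,n]∣n)
open import Data.Nat.ListAction using (sum)
open import Data.Nat.ListAction.Properties using (sum-↭)
open import Data.Nat.Primality using (euclidsLemma; ¬prime[0]; ¬prime[1])
open import Data.Nat.Properties
open import Data.Product using (∃; _,_; proj₁; proj₂)
open import Data.Sum using (inj₁; inj₂)
open import Data.Vec as Vec using (Vec; []; _∷_; replicate)
import Data.Vec.Relation.Unary.All as VecAll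
open import Function using (_∘_; id)
open import Level using (0ℓ)
open import Relation.Binary using (DecSetoid; Symmetric; Transitive)
open import Relation.Binary.PropositionalEquality using (_≡_; _≢_; refl; sym; trans; cong; cong₂; subst; module ≡-Reasoning)
open import Relation.Nullary using (¬_; does; yes; no; contradiction)
open import Relation.Unary using (Pred)

open import Algebra.Properties.CommutativeSemigroup +-commutativeSemigroup using (interchange; xy∙z≈xz∙y)

-- Finite sums

Σ₁-distrib-+ : ∀ k f g → Σ₁ k (λ i → f i + g i) ≡ Σ₁ k f + Σ₁ k g
Σ₁-distrib-+ zero    f g = refl
Σ₁-distrib-+ (suc k) f g rewrite Σ₁-distrib-+ k f g =
  interchange (Σ₁ k f) (Σ₁ k g) (f (suc k)) (g (suc k))

Σ₁-mono-≤ : ∀ k {f g} → (∀ i → 1 ≤ i → i ≤ k → f i ≤ g i) → Σ₁ k f ≤ Σ₁ k g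
Σ₁-mono-≤ zero    f≤g = z≤n
Σ₁-mono-≤ (suc k) f≤g =
  +-mono-≤ (Σ₁-mono-≤ k λ i 1≤i i≤k → f≤g i 1≤i (m≤n⇒m≤1+n i≤k)) (f≤g (suc k) (s≤s z≤n) ≤-refl)

Σ₁-*ʳ : ∀ k f a → Σ₁ k (λ i → f i * a) ≡ Σ₁ k f * a
Σ₁-*ʳ zero    f a = refl
Σ₁-*ʳ (suc k) f a rewrite Σ₁-*ʳ k f a = sym (*-distribʳ-+ a (Σ₁ k f) (f (suc k)))

term≤Σ₁ : ∀ k f {i} → 1 ≤ i → i ≤ k → f i ≤ Σ₁ k f
term≤Σ₁ zero    f 1≤i i≤0 = contradiction (≤-trans 1≤i i≤0) 1+n≰n
term≤Σ₁ (suc k) f {i} 1≤i i≤1+k with i ≟ suc k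
... | yes refl  = m≤n+m (f (suc k)) (Σ₁ k f)
... | no i≢1+k  = ≤-trans (term≤Σ₁ k f 1≤i (m<1+n⇒m≤n (≤∧≢⇒< i≤1+k i≢1+k))) (m≤m+n (Σ₁ k f) (f (suc k)))

module _ {A : Set} (f : A → ℕ) where

  multiplicity : ℕ → List A → ℕ
  multiplicity i xs = length (filter (λ x → f x ≟ i) xs)

  multiplicity-∷ : ∀ i x xs → multiplicity i (x ∷ xs) ≡ multiplicity i (x ∷ []) + multiplicity i xs
  multiplicity-∷ i x xs with does (f x ≟ i)
  ... | true  = refl
  ... | false = refl

  multiplicity-self : ∀ x → multiplicity (f x) (x ∷ []) ≡ 1
  multiplicity-self x = cong length (filter-accept (λ y → f y ≟ f x) refl)

  -- The summands are grouped by the value of `f`: an element with `f x ≤ k` feeds the term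
  -- `i = f x`, and any other has weight 0. The lower bound on `f` matters because `Σ₁` starts at
  -- index 1.
  sum≤Σ₁-multiplicity : ∀ k (w : ℕ → ℕ) → (∀ v → k < v → w v ≡ 0) → (∀ x → 1 ≤ f x) →
                        ∀ xs → sum (map (w ∘ f) xs) ≤ Σ₁ k (λ i → w i * multiplicity i xs)
  sum≤Σ₁-multiplicity k w w≡0 1≤f []       = z≤n
  sum≤Σ₁-multiplicity k w w≡0 1≤f (x ∷ xs) = begin
    w (f x) + sum (map (w ∘ f) xs)
      ≤⟨ +-mono-≤ head≤ (sum≤Σ₁-multiplicity k w w≡0 1≤f xs) ⟩
    Σ₁ k (λ i → w i * multiplicity i (x ∷ [])) + Σ₁ k (λ i → w i * multiplicity i xs)
      ≡⟨ Σ₁-distrib-+ k _ _ ⟨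
    Σ₁ k (λ i → w i * multiplicity i (x ∷ []) + w i * multiplicity i xs)
      ≤⟨ Σ₁-mono-≤ k (λ i _ _ → ≤-reflexive (trans
           (sym (*-distribˡ-+ (w i) (multiplicity i (x ∷ [])) (multiplicity i xs)))
           (cong (w i *_) (sym (multiplicity-∷ i x xs))))) ⟩
    Σ₁ k (λ i → w i * multiplicity i (x ∷ xs)) ∎
    where
    open ≤-Reasoning
    head≤ : w (f x) ≤ Σ₁ k (λ i → w i * multiplicity i (x ∷ []))
    head≤ with f x ≤? k
    ... | yes fx≤k = ≤-trans
          (≤-reflexive (sym (trans (cong (w (f x) *_) (multiplicity-self x)) (*-identityʳ (w (f x))))))
          (term≤Σ₁ k (λ i → w i * multiplicity i (x ∷ [])) (1≤f x) fx≤k)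
    ... | no fx≰k  = ≤-trans (≤-reflexive (w≡0 (f x) (≰⇒> fx≰k))) z≤n

sum-take≤sum : ∀ j xs → sum (take j xs) ≤ sum xs
sum-take≤sum zero    xs       = z≤n
sum-take≤sum (suc j) []       = z≤n
sum-take≤sum (suc j) (x ∷ xs) = +-monoʳ-≤ x (sum-take≤sum j xs)

-- Termwise `K ≤ v + (K ∸ v)`; for `v > K` the truncated difference is 0 and the bound still holds.
length*K≤sum+deficit : ∀ K vs → length vs * K ≤ sum vs + sum (map (K ∸_) vs)
length*K≤sum+deficit K []       = z≤n
length*K≤sum+deficit K (v ∷ vs) = ≤-trans
  (+-mono-≤ (m≤n+m∸n K v) (length*K≤sum+deficit K vs))
  (≤-reflexive (interchange v (K ∸ v) (sum vs) (sum (map (K ∸_) vs))))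

-- Pigeonhole

module _ {A B : Set} (R : A → B → Set) where

  -- A relation replaces the usual injection because hyperplanes are matched only up to `_≈_`.
  -- Sending `i` to the position of a partner is injective: equal positions share the partner `y`.
  pigeonhole-≤ : ∀ {j} (f : Fin j → A) ys → (∀ i → Any (R (f i)) ys) →
                 (∀ {i i′ y} → R (f i) y → R (f i′) y → i ≡ i′) → j ≤ length ys
  pigeonhole-≤ f ys R-total R-inj = injective⇒≤ {f = λ i → Any.index (R-total i)} λ {i} {i′} eq →
    R-inj (Any.lookup-index (R-total i))
          (subst (λ p → R (f i′) (lookup ys p)) (sym eq) (Any.lookup-index (R-total i′)))

-- `AllPairs` only compares an earlier entry with a later one; symmetry of `R` handles the reverse
-- order.
lookup-injective : ∀ {A : Set} {R : A → A → Set} → Symmetric R →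
                   ∀ {xs} → AllPairs (λ x y → ¬ R x y) xs →
                   ∀ i j → R (lookup xs i) (lookup xs j) → i ≡ j
lookup-injective R-sym (_  ∷ _)   zero    zero    _ = refl
lookup-injective R-sym (x# ∷ _)   zero    (suc j) r = contradiction r (All.lookup x# (∈-lookup j))
lookup-injective R-sym (x# ∷ _)   (suc i) zero    r = contradiction (R-sym r) (All.lookup x# (∈-lookup i))
lookup-injective R-sym (_  ∷ xs#) (suc i) (suc j) r = cong suc (lookup-injective R-sym xs# i j r)

-- Vectors

∈-tuples : ∀ {A : Set} {xs : List A} {m} {v : Vec A m} → VecAll.All (_∈ xs) v → v ∈ tuples m xs
∈-tuples VecAll.[]         = here refl
∈-tuples (x∈ VecAll.∷ v∈) = ∈-cartesianProductWith⁺ _∷_ x∈ (∈-tuples v∈)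

entries≤sum : ∀ {m} (v : Vec ℕ m) → VecAll.All (_≤ Vec.sum v) v
entries≤sum []      = VecAll.[]
entries≤sum (a ∷ v) = m≤m+n a (Vec.sum v) VecAll.∷ VecAll.map (λ b≤ → ≤-trans b≤ (m≤n+m (Vec.sum v) a)) (entries≤sum v)

sum-zeros : ∀ m → Vec.sum (replicate m 0) ≡ 0
sum-zeros zero    = refl
sum-zeros (suc m) = sum-zeros m

sum≡0⇒zeros : ∀ {m} (v : Vec ℕ m) → Vec.sum v ≡ 0 → v ≡ replicate m 0
sum≡0⇒zeros []          _  = refl
sum≡0⇒zeros (zero ∷ v)  eq = cong (0 ∷_) (sum≡0⇒zeros v eq)

sum-scale : ∀ d {m} (v : Vec ℕ m) → Vec.sum (Vec.map (d *_) v) ≡ d * Vec.sum v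
sum-scale d []      = sym (*-zeroʳ d)
sum-scale d (a ∷ v) = trans (cong (d * a +_) (sum-scale d v)) (sym (*-distribˡ-+ d a (Vec.sum v)))

dot-scale : ∀ d {m} (u v : Vec ℕ m) →
            Vec.sum (Vec.zipWith _*_ (Vec.map (d *_) u) v) ≡ d * Vec.sum (Vec.zipWith _*_ u v)
dot-scale d []      []      = sym (*-zeroʳ d)
dot-scale d (a ∷ u) (b ∷ v) = trans
  (cong₂ _+_ (*-assoc d a b) (dot-scale d u v))
  (sym (*-distribˡ-+ d (a * b) (Vec.sum (Vec.zipWith _*_ u v))))

-- Normals

∣∧<⇒≡0 : ∀ {N a} → N ∣ a → a < N → a ≡ 0
∣∧<⇒≡0 {a = zero}  _   _   = refl
∣∧<⇒≡0 {a = suc a} N∣a a<N = contradiction (∣⇒≤ N∣a) (<⇒≱ a<N)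

weight≡0⇒zero : ∀ {N m} (h : Point N m) → weight h ≡ 0 → representatives h ≡ replicate m 0
weight≡0⇒zero h = sum≡0⇒zeros (representatives h)

-- The gcd divides every entry, and a representative below `N` is divisible by `N` only if it is 0.
N∣gcd⇒zero : ∀ {N m} (h : Point N m) → N ∣ gcdVec (representatives h) → representatives h ≡ replicate m 0
N∣gcd⇒zero []      _   = refl
N∣gcd⇒zero (a ∷ h) N∣g = cong₂ _∷_
  (∣∧<⇒≡0 (∣-trans N∣g (gcd[m,n]∣m (toℕ a) (gcdVec (representatives h)))) (toℕ<n a))
  (N∣gcd⇒zero h (∣-trans N∣g (gcd[m,n]∣n (toℕ a) (gcdVec (representatives h)))))

quotientPoint : ∀ {N m} (h : Point N m) d .{{_ : NonZero d}} → d ∣ gcdVec (representatives h) →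
                ∃ λ (q : Point N m) → representatives h ≡ Vec.map (d *_) (representatives q)
quotientPoint []      d _   = [] , refl
quotientPoint (a ∷ h) d d∣g
  with ∣-trans d∣g (gcd[m,n]∣m (toℕ a) (gcdVec (representatives h)))
     | quotientPoint h d (∣-trans d∣g (gcd[m,n]∣n (toℕ a) (gcdVec (representatives h))))
... | divides b a≡b*d | q , h≡d*q = fromℕ< b<N ∷ q , cong₂ _∷_ a≡d*b h≡d*q
  where
  -- From `b ≤ b * d = a < N` the quotient is itself a representative, so the division takes place
  -- in ℕ and not merely mod `N`; weights therefore scale by exactly `d`.
  b<N = ≤-<-trans (≤-trans (m≤m*n b d) (≤-reflexive (sym a≡b*d))) (toℕ<n a)
  a≡d*b = trans a≡b*d (trans (*-comm b d) (cong (d *_) (sym (toℕ-fromℕ< b<N))))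

module _ {N m : ℕ} where

  ≈-sym : Symmetric (_≈_ {N} {m})
  ≈-sym (p , q) = q , p

  ≈-trans : Transitive (_≈_ {N} {m})
  ≈-trans (p , q) (p′ , q′) = (p′ ∘ p) , (q ∘ q′)

  hyperplaneDecSetoid : DecSetoid 0ℓ 0ℓ
  hyperplaneDecSetoid = record
    { Carrier = Hyperplane N m
    ; _≈_     = _≈_
    ; isDecEquivalence = record
      { isEquivalence = record
        { refl  = id , id
        ; sym   = λ {H} {H′} → ≈-sym {H} {H′}
        ; trans = λ {H} {H′} {H″} → ≈-trans {H} {H′} {H″} }
      ; _≟_ = _≈?_ } }

  minNormal : Hyperplane N m → Point N m
  minNormal H = proj₁ (proj₁ (proj₂ (minNormalWeight H)))

  minNormal-isNormal : ∀ H → IsNormal H (minNormal H)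
  minNormal-isNormal H = proj₁ (proj₂ (proj₁ (proj₂ (minNormalWeight H))))

  weight-minNormal : ∀ H → weight (minNormal H) ≡ n H
  weight-minNormal H = proj₂ (proj₂ (proj₁ (proj₂ (minNormalWeight H))))

  n≤weight : ∀ (H : Hyperplane N m) h → IsNormal H h → n H ≤ weight h
  n≤weight H h normal = proj₂ (proj₂ (minNormalWeight H)) (weight h) (h , normal , refl)

  n-positive : ∀ H → 1 ≤ n H
  n-positive H = n≢0⇒n>0 λ n≡0 →
    proj₁ (minNormal-isNormal H) (weight≡0⇒zero (minNormal H) (trans (weight-minNormal H) n≡0))

  -- A normal determines its hyperplane, and `h · x` depends on `h` only through its
  -- representatives. These are compared because `c` counts vectors over ℕ.
  minNormal-injective : ∀ {H H′} → representatives (minNormal H) ≡ representatives (minNormal H′) → H ≈ H′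
  minNormal-injective {H} {H′} eq =
    (λ {x} x∈H  → proj₂ H′≐h′ (subst (N∣_· x) eq (proj₁ H≐h x∈H))) ,
    (λ {x} x∈H′ → proj₂ H≐h (subst (N∣_· x) (sym eq) (proj₁ H′≐h′ x∈H′)))
    where
    N∣_·_ : Vec ℕ m → Point N m → Set
    N∣ v · x = N ∣ Vec.sum (Vec.zipWith _*_ v (representatives x))
    H≐h   = proj₂ (minNormal-isNormal H)
    H′≐h′ = proj₂ (minNormal-isNormal H′)

  -- The quotient `q` of `h` by its gcd `d` is again a normal of `H`, so minimality gives
  -- `d * weight q ≤ weight q` with `weight q` nonzero.
  minNormal-primitive : Prime N → ∀ H → gcdVec (representatives (minNormal H)) ≡ 1
  minNormal-primitive N-prime H = ≤-antisym d≤1 (n≢0⇒n>0 d≢0)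
    where
    h = minNormal H
    d = gcdVec (representatives h)
    h≢0 = proj₁ (minNormal-isNormal H)
    H≐h = proj₂ (minNormal-isNormal H)

    N∤d : ¬ N ∣ d
    N∤d = h≢0 ∘ N∣gcd⇒zero h

    d≢0 : d ≢ 0
    d≢0 d≡0 = N∤d (subst (N ∣_) (sym d≡0) (N ∣0))

    instance
      d-nonZero : NonZero d
      d-nonZero = ≢-nonZero d≢0

    q = proj₁ (quotientPoint h d ∣-refl)
    h≡d*q = proj₂ (quotientPoint h d ∣-refl)

    weight-h : weight h ≡ d * weight q
    weight-h = trans (cong Vec.sum h≡d*q) (sum-scale d (representatives q))

    weight-q≢0 : weight q ≢ 0
    weight-q≢0 eq = h≢0 (weight≡0⇒zero h (trans weight-h (trans (cong (d *_) eq) (*-zeroʳ d))))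

    h·x≡d*q·x : ∀ x → h · x ≡ d * (q · x)
    h·x≡d*q·x x = trans (cong (λ v → Vec.sum (Vec.zipWith _*_ v (representatives x))) h≡d*q)
                        (dot-scale d (representatives q) (representatives x))

    cancel-d : ∀ x → N ∣ d * (q · x) → N ∣ q · x
    -- Primality makes `d` cancellable mod `N`, since `N` does not divide `d`.
    cancel-d x N∣ with euclidsLemma d (q · x) N-prime N∣
    ... | inj₁ N∣d   = contradiction N∣d N∤d
    ... | inj₂ N∣q·x = N∣q·x

    q-isNormal : IsNormal H q
    q-isNormal =
      (λ q≡0 → weight-q≢0 (trans (cong Vec.sum q≡0) (sum-zeros m))) ,
      (λ {x} x∈H → cancel-d x (subst (N ∣_) (h·x≡d*q·x x) (proj₁ H≐h x∈H))) ,
      (λ {x} x∈q → proj₂ H≐h (subst (N ∣_) (sym (h·x≡d*q·x x)) (∣n⇒∣m*n d x∈q)))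

    d≤1 : d ≤ 1
    d≤1 = *-cancelʳ-≤ d 1 (weight q) {{≢-nonZero weight-q≢0}} (begin
      d * weight q ≡⟨ weight-h ⟨
      weight h     ≡⟨ weight-minNormal H ⟩
      n H          ≤⟨ n≤weight H q q-isNormal ⟩
      weight q     ≡⟨ *-identityˡ (weight q) ⟨
      1 * weight q ∎)
      where open ≤-Reasoning

-- Counting hyperplanes

hyperplanes-distinct : ∀ m N → AllPairs (λ H H′ → ¬ H ≈ H′) (hyperplanes m N)
hyperplanes-distinct m N =
  deduplicate-! hyperplaneDecSetoid (toList (all-filter nonzero? (tuples m (allFin N))))

∈-toList : ∀ {A : Set} {P : Pred A 0ℓ} {x xs} (pxs : All P xs) → x ∈ xs → Any (λ y → proj₁ y ≡ x) (toList pxs)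
∈-toList (_ ∷ _)   (here refl) = here refl
∈-toList (_ ∷ pxs) (there x∈)  = there (∈-toList pxs x∈)

-- `toList` attaches its own proof of `Nonzero` to each point; `_≈_` sees only the normals, so the
-- two proofs are never compared.
sameNormal : ∀ {N m} {H H′ : Hyperplane N m} → proj₁ H′ ≡ proj₁ H → H ≈ H′
sameNormal refl = (λ x∈H → x∈H) , (λ x∈H → x∈H)

-- Deduplication may drop `H` itself, but only in favour of an entry with the same underlying set,
-- and `H ≈_` is invariant under such a replacement.
hyperplanes-complete : ∀ {m N} (H : Hyperplane N m) → Any (H ≈_) (hyperplanes m N)
hyperplanes-complete {m} {N} H@(h , h≢0) =
  Any.deduplicate⁺ _≈?_
    (λ {H₁} {H₂} H₂≈H₁ H≈H₁ → ≈-trans {i = H} {H₁} {H₂} H≈H₁ (≈-sym {x = H₂} {H₁} H₂≈H₁))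
    (Any.map (λ {H′} → sameNormal {H = H} {H′})
      (∈-toList (all-filter nonzero? (tuples m (allFin N)))
        (∈-filter⁺ nonzero? (∈-tuples (VecAll.universal ∈-allFin h)) h≢0)))

-- A hyperplane with `n H = i` is sent to the representatives of its least normal, a primitive
-- vector of sum `i`; distinct hyperplanes have distinct images.
multiplicity-n≤c : ∀ {N} → Prime N → ∀ m i → multiplicity n i (hyperplanes m N) ≤ c i m
multiplicity-n≤c {N} N-prime m i = pigeonhole-≤ (λ H v → representatives (minNormal H) ≡ v)
  (lookup Hs) _ member
  λ {j} {j′} eq eq′ → lookup-injective (λ {H} {H′} → ≈-sym {x = H} {H′})
    (AllPairs.filter⁺ n≟i (hyperplanes-distinct m N)) j j′
    (minNormal-injective {H = lookup Hs j} {lookup Hs j′} (trans eq (sym eq′)))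
  where
  n≟i = λ (H : Hyperplane N m) → n H ≟ i
  Hs = filter n≟i (hyperplanes m N)

  member : ∀ j → representatives (minNormal (lookup Hs j)) ∈ filter (primitiveOfSum? i) (tuples m (upTo (suc i)))
  member j = ∈-filter⁺ (primitiveOfSum? i)
    -- Each entry is at most the sum `i`, so the vector lies in the box searched by `c`.
    (∈-tuples (VecAll.map (λ a≤ → ∈-upTo⁺ (s≤s (≤-trans a≤ (≤-reflexive sum≡i)))) (entries≤sum _)))
    (sum≡i , minNormal-primitive N-prime H)
    where
    H = lookup Hs j
    sum≡i = trans (weight-minNormal H) (All.lookup (all-filter n≟i (hyperplanes m N)) (∈-lookup j))

-- (a, N−1, 0, …) is orthogonal to (1, b, 0, …) exactly when a = b.
module _ (N′ m′ : ℕ) where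

  private
    N m : ℕ
    N = suc (suc N′)
    m = suc (suc m′)

  planarPoint : Fin N → Fin N → Point N m
  planarPoint a b = a ∷ b ∷ replicate m′ zero

  planarPoint-· : ∀ a b a′ b′ → planarPoint a b · planarPoint a′ b′ ≡ toℕ a * toℕ a′ + toℕ b * toℕ b′
  planarPoint-· a b a′ b′ =
    cong (toℕ a * toℕ a′ +_) (trans (cong (toℕ b * toℕ b′ +_) (zeros·zeros m′)) (+-identityʳ _))
    where
    zeros·zeros : ∀ m → replicate m (zero {suc N′}) · replicate m zero ≡ 0
    zeros·zeros zero    = refl
    zeros·zeros (suc m) = zeros·zeros m

  -- For prime `N` these normals represent the `N + 1` points of a projective line: `zero` is the
  -- point at infinity, and `suc a` has normal (a, -1, 0, ...), with `fromℕ (suc N′)` as -1.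
  planarHyperplane : Fin (suc N) → Hyperplane N m
  planarHyperplane zero    = planarPoint (suc zero) zero , λ ()
  planarHyperplane (suc a) = planarPoint a (fromℕ (suc N′)) , λ ()

  infinity≉ : ∀ a → ¬ planarHyperplane zero ≈ planarHyperplane (suc a)
  infinity≉ a (to , _) = contradiction (∣∧<⇒≡0 N∣N-1 ≤-refl) λ ()
    where
    -- The point (0, 1, 0, ...) lies on the hyperplane of index `zero`, but its product with (a,
    -- N-1, 0, ...) is N-1, strictly between 0 and `N`.
    x = planarPoint zero (suc zero)
    N∣N-1 : N ∣ suc N′
    N∣N-1 = subst (N ∣_)
      (trans (planarPoint-· a (fromℕ (suc N′)) zero (suc zero))
        (cong₂ _+_ (*-zeroʳ (toℕ a)) (trans (*-identityʳ _) (toℕ-fromℕ (suc N′)))))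
      (to {x} (subst (N ∣_) (sym (planarPoint-· (suc zero) zero zero (suc zero))) (N ∣0)))

  affine·slope : ∀ a b → planarPoint b (fromℕ (suc N′)) · planarPoint (suc zero) a ≡ toℕ b + suc N′ * toℕ a
  affine·slope a b = trans (planarPoint-· b (fromℕ (suc N′)) (suc zero) a)
    (cong₂ _+_ (*-identityʳ (toℕ b)) (cong (_* toℕ a) (toℕ-fromℕ (suc N′))))

  -- The point (1, a, 0, ...) lies on the first hyperplane, hence on the second, so `N` divides
  -- `b ∸ a`, which is less than `N`. Assuming `a ≤ b` makes this a true difference.
  affine-≤ : ∀ a b → planarHyperplane (suc a) ≈ planarHyperplane (suc b) → toℕ a ≤ toℕ b → toℕ b ≤ toℕ a
  affine-≤ a b (to , _) a≤b = m∸n≡0⇒m≤n (∣∧<⇒≡0 N∣b∸a (≤-<-trans (m∸n≤m (toℕ b) (toℕ a)) (toℕ<n b)))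
    where
    open ≡-Reasoning
    x = planarPoint (suc zero) a

    b+[N-1]a : toℕ b + suc N′ * toℕ a ≡ N * toℕ a + (toℕ b ∸ toℕ a)
    b+[N-1]a = begin
      toℕ b + suc N′ * toℕ a                     ≡⟨ cong (_+ suc N′ * toℕ a) (m∸n+n≡m a≤b) ⟨
      toℕ b ∸ toℕ a + toℕ a + suc N′ * toℕ a     ≡⟨ +-assoc (toℕ b ∸ toℕ a) (toℕ a) _ ⟩
      -- The sum `toℕ a + suc N′ * toℕ a` is `N * toℕ a` by definition.
      toℕ b ∸ toℕ a + N * toℕ a                  ≡⟨ +-comm (toℕ b ∸ toℕ a) _ ⟩
      N * toℕ a + (toℕ b ∸ toℕ a)                ∎

    N∣b∸a : N ∣ toℕ b ∸ toℕ a
    N∣b∸a = ∣m+n∣m⇒∣n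
      (subst (N ∣_) (trans (affine·slope a b) b+[N-1]a)
        (to {x} (subst (N ∣_) (sym (affine·slope a a)) (m∣m*n (toℕ a)))))
      (m∣m*n (toℕ a))

  planarHyperplane-injective : ∀ i j → planarHyperplane i ≈ planarHyperplane j → i ≡ j
  planarHyperplane-injective zero    zero    _ = refl
  planarHyperplane-injective zero    (suc b) e = contradiction e (infinity≉ b)
  planarHyperplane-injective (suc a) zero    e =
    contradiction (≈-sym {x = planarHyperplane (suc a)} {planarHyperplane zero} e) (infinity≉ a)
  planarHyperplane-injective (suc a) (suc b) e = cong suc (toℕ-injective a≡b)
    where
    e′ = ≈-sym {x = planarHyperplane (suc a)} {planarHyperplane (suc b)} e
    a≡b : toℕ a ≡ toℕ b
    a≡b with ≤-total (toℕ a) (toℕ b)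
    ... | inj₁ a≤b = ≤-antisym a≤b (affine-≤ a b e a≤b)
    ... | inj₂ b≤a = ≤-antisym (affine-≤ b a e′ b≤a) b≤a

N+1≤length-hyperplanes : ∀ {N} → Prime N → ∀ {m} → 2 ≤ m → N + 1 ≤ length (hyperplanes m N)
-- Primality excludes 0 and 1, leaving room for the distinct residues 0 and 1 in the planar normals.
N+1≤length-hyperplanes {zero}        N-prime _ = contradiction N-prime ¬prime[0]
N+1≤length-hyperplanes {suc zero}    N-prime _ = contradiction N-prime ¬prime[1]
N+1≤length-hyperplanes {N@(suc (suc N′))} _ {suc (suc m′)} (s≤s (s≤s z≤n)) =
  ≤-trans (≤-reflexive (+-comm N 1))
    (pigeonhole-≤ _≈_ P (hyperplanes _ N) (λ i → hyperplanes-complete (P i))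
      λ {i} {i′} {H} e e′ → planarHyperplane-injective N′ m′ i i′
        (≈-trans {i = P i} {H} {P i′} e (≈-sym {x = P i′} {H} e′)))
  where P = planarHyperplane N′ m′

-- Comparison of the two sums

Σ₁c≤N+1 : ∀ m N 2≤m → Σ₁ (kᶻ m N 2≤m) (λ i → c i m) ≤ N + 1
Σ₁c≤N+1 m N 2≤m with minExceeding m N 2≤m
... | zero  , _         = z≤n
... | suc k , _ , least = ≮⇒≥ λ exceeds →
  -- `ExceedsAt` at `k` sums up to `k + 1`, so an excess at `suc k` would already make the
  -- predecessor `k` qualify.
  1+n≰n (least k (subst (λ j → N + 1 < Σ₁ j (λ i → c i m)) (+-comm 1 k) exceeds))

module _ (N : ℕ) (N-prime : Prime N) (m : ℕ) (2≤m : 2 ≤ m) where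

  private
    k K C : ℕ
    k = kᶻ m N 2≤m
    K = k + 1
    C = Σ₁ k (λ i → c i m)

    deficit : ℕ
    deficit = Σ₁ k (λ i → (K ∸ i) * c i m)

    values smallest : List ℕ
    values   = map n (hyperplanes m N)
    smallest = take (N + 1) (sort ≤-decTotalOrder values)

  -- Each term `i * c i m` is topped up to `K * c i m`, and the remaining `N + 1 ∸ C` units already
  -- count `K` each. The two sides are in fact equal.
  Sᶻ+deficit≤ : Sᶻ m N 2≤m + deficit ≤ (N + 1) * K
  Sᶻ+deficit≤ = begin
    Σ₁ k (λ i → i * c i m) + (N + 1 ∸ C) * K + deficit
      ≡⟨ xy∙z≈xz∙y (Σ₁ k (λ i → i * c i m)) ((N + 1 ∸ C) * K) deficit ⟩
    (Σ₁ k (λ i → i * c i m) + deficit) + (N + 1 ∸ C) * K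
      ≡⟨ cong (_+ (N + 1 ∸ C) * K) (Σ₁-distrib-+ k _ _) ⟨
    Σ₁ k (λ i → i * c i m + (K ∸ i) * c i m) + (N + 1 ∸ C) * K
      -- The terms agree only for `i ≤ k`, a bound that `Σ₁-mono-≤` supplies.
      ≤⟨ +-monoˡ-≤ _ (Σ₁-mono-≤ k λ i _ i≤k → ≤-reflexive (term i i≤k)) ⟩
    Σ₁ k (λ i → c i m * K) + (N + 1 ∸ C) * K
      ≡⟨ cong (_+ (N + 1 ∸ C) * K) (Σ₁-*ʳ k _ K) ⟩
    C * K + (N + 1 ∸ C) * K
      ≡⟨ *-distribʳ-+ K C (N + 1 ∸ C) ⟨
    (C + (N + 1 ∸ C)) * K
      ≡⟨ cong (_* K) (m+[n∸m]≡n (Σ₁c≤N+1 m N 2≤m)) ⟩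
    (N + 1) * K ∎
    where
    open ≤-Reasoning
    term : ∀ i → i ≤ k → i * c i m + (K ∸ i) * c i m ≡ c i m * K
    term i i≤k = trans (sym (*-distribʳ-+ (c i m) i (K ∸ i)))
      (trans (cong (_* c i m) (m+[n∸m]≡n (≤-trans i≤k (m≤m+n k 1)))) (*-comm K (c i m)))

  -- The supply of `N + 1` hyperplanes enters here: `take` would return a shorter list otherwise.
  length-smallest : length smallest ≡ N + 1
  length-smallest = trans (length-take (N + 1) (sort ≤-decTotalOrder values))
    (m≤n⇒m⊓n≡m (≤-trans (N+1≤length-hyperplanes N-prime 2≤m) (≤-reflexive (sym
      (trans (↭-length (sort-↭ ≤-decTotalOrder values)) (length-map n (hyperplanes m N)))))))

  -- Deficits are nonnegative, so passing from the selected values to all of them only increases the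
  -- total. That total ignores order and can be grouped by value; values above `k` contribute 0.
  deficit-smallest≤ : sum (map (K ∸_) smallest) ≤ deficit
  deficit-smallest≤ = begin
    sum (map (K ∸_) smallest)
      ≡⟨ cong sum (take-map (N + 1) (sort ≤-decTotalOrder values)) ⟨
    sum (take (N + 1) (map (K ∸_) (sort ≤-decTotalOrder values)))
      ≤⟨ sum-take≤sum (N + 1) _ ⟩
    sum (map (K ∸_) (sort ≤-decTotalOrder values))
      ≡⟨ sum-↭ (map⁺ (K ∸_) (sort-↭ ≤-decTotalOrder values)) ⟩
    sum (map (K ∸_) values)
      ≡⟨ cong sum (map-∘ (hyperplanes m N)) ⟨
    sum (map (λ H → K ∸ n H) (hyperplanes m N))
      ≤⟨ sum≤Σ₁-multiplicity n k (K ∸_) K∸v≡0 n-positive (hyperplanes m N) ⟩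
    Σ₁ k (λ i → (K ∸ i) * multiplicity n i (hyperplanes m N))
      ≤⟨ Σ₁-mono-≤ k (λ i _ _ → *-monoʳ-≤ (K ∸ i) (multiplicity-n≤c N-prime m i)) ⟩
    deficit ∎
    where
    open ≤-Reasoning
    K∸v≡0 : ∀ v → k < v → K ∸ v ≡ 0
    K∸v≡0 v k<v = m≤n⇒m∸n≡0 (≤-trans (≤-reflexive (+-comm k 1)) k<v)

  Sᶻ≤S : Sᶻ m N 2≤m ≤ S m N
  -- Adding the deficit to both sides avoids subtracting it in ℕ.
  Sᶻ≤S = +-cancelʳ-≤ deficit _ _ (begin
    Sᶻ m N 2≤m + deficit                     ≤⟨ Sᶻ+deficit≤ ⟩
    (N + 1) * K                              ≡⟨ cong (_* K) length-smallest ⟨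
    length smallest * K                      ≤⟨ length*K≤sum+deficit K smallest ⟩
    sum smallest + sum (map (K ∸_) smallest) ≤⟨ +-monoʳ-≤ (sum smallest) deficit-smallest≤ ⟩
    S m N + deficit                          ∎)
    where open ≤-Reasoning

lemma2p19 : (N : ℕ) → Prime N → (m : ℕ) → (2≤m : 2 ≤ m) → S m N ≥ Sᶻ m N 2≤m
lemma2p19 = Sᶻ≤S
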